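{- For every finite simple graph $G$ and every positive integer $n$, $$\chi_i(G)\le \chi_i(S_G^n)\le \chi_i(G)+1.$$ Moreover, both bounds are attained: there exist graphs $G$ (e.g. $G=K_p$ with $p\ge 3$, or $G=C_k$ with $k\ge 3$, $k\not\equiv 0\pmod 4$) with $\chi_i(S_G^n)=\chi_i(G)$ for all $n\ge 1$, and there exist graphs $G$ (e.g. $G=C_k$ with $k\equiv 0\pmod 4$) with $\chi_i(S_G^n)=\chi_i(G)+1$ for all $n\ge 2$.
   Context: For a graph $H$, an injective $k$-coloring is a map $f:V(H)\to\{1,\dots,k\}$ such that any two distinct vertices $u,w$ with $f(u)=f(w)$ have no common neighbor; $\chi_i(H)$ is the least such $k$. For a graph $G$ and positive integer $n$, the generalized Sierpiński graph $S_G^n$ has vertex set $V(G)^n$, and $(u_1,\dots,u_n)$, $(v_1,\dots,v_n)$ are adjacent if and only if there is $d\in\{1,\dots,n\}$ with $u_i=v_i$ for $i<d$, $u_dv_d\in E(G)$, and $u_i=v_d$, $v_i=u_d$ for all $i>d$. $K_p$ is the complete graph on $p$ vertices and $C_k$ the cycle on $k$ vertices. -}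

module Defs where

open import Data.Empty using (⊥-elim)
open import Data.Fin as Fin using (Fin; zero; toℕ; finToFun; funToFin)
open import Data.Fin.Properties as Finₚ using (any?; all?; *↔×; finToFun-funToFin)
open import Data.Nat using (ℕ; zero; suc; _≤_; _^_; z≤n; s≤s)
import Data.Nat.Properties as ℕₚ
open import Data.Product using (_×_; _,_; proj₁; proj₂; ∃; ∃-syntax)
open import Data.Product.Function.NonDependent.Propositional using (_×-↔_)
open import Data.Sum using (_⊎_; inj₁; inj₂; swap)
open import Data.Vec using (Vec; []; _∷_; lookup; head; tail)
open import Function using (_∘_; _↔_; mk↔ₛ′)
open import Function.Bundles using (Inverse)
open import Function.Properties.Inverse using (↔-refl; ↔-trans; ↔-sym; ↔⇒↣)
open import Relation.Binary.Definitions using (Decidable; DecidableEquality; Symmetric; Irreflexive)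
open import Relation.Binary.PropositionalEquality
open import Relation.Nullary using (¬_; Dec; yes; no)
open import Relation.Nullary.Decidable using (map′; _×-dec_; _⊎-dec_; _→-dec_; ¬?; via-injection)

-- Adjacency is decidable so that graph invariants such as χᵢ can be
-- computed; classically this is no restriction.  Only the inhabitedness
-- of Adj u v is ever used, so there are no multiple edges.
record Graph : Set₁ where
  field
    V          : Set
    order      : ℕ
    enum       : V ↔ Fin order
    Adj        : V → V → Set
    Adj?       : Decidable Adj
    Adj-sym    : Symmetric Adj
    Adj-irrefl : Irreflexive _≡_ Adj

  _≟ⱽ_ : DecidableEquality V
  _≟ⱽ_ = via-injection (↔⇒↣ enum) Finₚ._≟_

  open Inverse enum public using () renaming
    (to to index; from to vertex; strictlyInverseˡ to index∘vertex; strictlyInverseʳ to vertex∘index)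

  anyV? : ∀ {P : V → Set} → (∀ v → Dec (P v)) → Dec (∃ P)
  anyV? {P} P? = map′
    (λ (i , p) → vertex i , p)
    (λ (v , p) → index v , subst P (sym (vertex∘index v)) p)
    (any? (P? ∘ vertex))

  allV? : ∀ {P : V → Set} → (∀ v → Dec (P v)) → Dec (∀ v → P v)
  allV? {P} P? = map′
    (λ f v → subst P (vertex∘index v) (f (index v)))
    (λ f i → f (vertex i))
    (all? (P? ∘ vertex))

module _ (H : Graph) where
  open Graph H

  CommonNeighbor : V → V → Set
  CommonNeighbor u w = ∃[ x ] Adj u x × Adj w x

  IsInjectiveColoring : ∀ {k} → (V → Fin k) → Set
  IsInjectiveColoring f = ∀ u w → u ≢ w → f u ≡ f w → ¬ CommonNeighbor u w

  InjectivelyColorable : ℕ → Set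
  InjectivelyColorable k = ∃[ f ] IsInjectiveColoring {k} f

  isInjectiveColoring? : ∀ {k} (f : V → Fin k) → Dec (IsInjectiveColoring f)
  isInjectiveColoring? f = allV? λ u → allV? λ w →
    ¬? (u ≟ⱽ w) →-dec ((f u Finₚ.≟ f w) →-dec ¬? (anyV? λ x → Adj? u x ×-dec Adj? w x))

  injectivelyColorable? : ∀ k → Dec (InjectivelyColorable k)
  injectivelyColorable? k = map′
    (λ (c , p) → finToFun c ∘ index , p)
    (λ (f , p) → funToFin (f ∘ vertex) , λ u w u≢w eq →
       p u w u≢w (trans (sym (decode f u)) (trans eq (decode f w))))
    (any? {k ^ order} λ c → isInjectiveColoring? (finToFun c ∘ index))
    where
    decode : ∀ (f : V → Fin k) v → finToFun (funToFin (f ∘ vertex)) (index v) ≡ f v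
    decode f v = trans (finToFun-funToFin (f ∘ vertex) (index v)) (cong f (vertex∘index v))

  order-colorable : InjectivelyColorable order
  order-colorable = index , λ u w u≢w eq _ →
    u≢w (trans (sym (vertex∘index u)) (trans (cong vertex eq) (vertex∘index w)))

IsLeast : (ℕ → Set) → ℕ → Set
IsLeast P k = P k × (∀ j → P j → k ≤ j)

least : ∀ {P : ℕ → Set} → (∀ k → Dec (P k)) → ∀ n → P n → ∃ (IsLeast P)
least P? zero    p = zero , p , λ _ _ → z≤n
least {P} P? (suc n) p with P? zero
... | yes p₀ = zero , p₀ , λ _ _ → z≤n
... | no ¬p₀ with least (P? ∘ suc) n p
...   | k , pk , min = suc k , pk , λ where
        zero    p₀ → ⊥-elim (¬p₀ p₀)
        (suc j) pj → s≤s (min j pj)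

least-injectivelyColorable : ∀ H → ∃ (IsLeast (InjectivelyColorable H))
least-injectivelyColorable H =
  least (injectivelyColorable? H) (Graph.order H) (order-colorable H)

χᵢ : Graph → ℕ
χᵢ H = proj₁ (least-injectivelyColorable H)

χᵢ-isLeast : ∀ H → IsLeast (InjectivelyColorable H) (χᵢ H)
χᵢ-isLeast H = proj₂ (least-injectivelyColorable H)

Vec↔Fin : ∀ {A : Set} {m} → A ↔ Fin m → ∀ n → Vec A n ↔ Fin (m ^ n)
Vec↔Fin e zero    = mk↔ₛ′ (λ _ → zero) (λ _ → []) (λ { zero → refl }) (λ { [] → refl })
Vec↔Fin e (suc n) = ↔-trans uncons (↔-trans (e ×-↔ Vec↔Fin e n) (↔-sym *↔×))
  where
  uncons : Vec _ (suc n) ↔ (_ × Vec _ n)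
  uncons = mk↔ₛ′ (λ xs → head xs , tail xs) (λ (x , xs) → x ∷ xs)
    (λ _ → refl) (λ { (_ ∷ _) → refl })

module _ (G : Graph) (n : ℕ) where
  open Graph G

  SierpińskiAdj : Vec V n → Vec V n → Set
  SierpińskiAdj u v = ∃[ d ]
      (∀ i → i Fin.< d → lookup u i ≡ lookup v i)
    × Adj (lookup u d) (lookup v d)
    × (∀ i → d Fin.< i → lookup u i ≡ lookup v d × lookup v i ≡ lookup u d)

  Sierpiński : Graph
  Sierpiński = record
    { V          = Vec V n
    ; order      = order ^ n
    ; enum       = Vec↔Fin enum n
    ; Adj        = SierpińskiAdj
    ; Adj?       = λ u v → any? λ d →
        all? (λ i → (i Finₚ.<? d) →-dec (lookup u i ≟ⱽ lookup v i))
        ×-dec Adj? (lookup u d) (lookup v d)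
        ×-dec all? (λ i → (d Finₚ.<? i) →-dec
          ((lookup u i ≟ⱽ lookup v d) ×-dec (lookup v i ≟ⱽ lookup u d)))
    ; Adj-sym    = λ (d , before , at , after) →
        d , (λ i i<d → sym (before i i<d)) , Adj-sym at
          , (λ i d<i → proj₂ (after i d<i) , proj₁ (after i d<i))
    ; Adj-irrefl = λ { refl (d , _ , at , _) → Adj-irrefl refl at }
    }

K : ℕ → Graph
K p = record
  { V          = Fin p
  ; order      = p
  ; enum       = ↔-refl
  ; Adj        = _≢_
  ; Adj?       = λ u v → ¬? (u Finₚ.≟ v)
  ; Adj-sym    = λ u≢v v≡u → u≢v (sym v≡u)
  ; Adj-irrefl = λ u≡v u≢v → u≢v u≡v
  }

CyclicSuc : ∀ {k} → Fin k → Fin k → Set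
CyclicSuc {k} u v = (toℕ v ≡ suc (toℕ u)) ⊎ (suc (toℕ u) ≡ k × toℕ v ≡ 0)

C : (k : ℕ) → 3 ≤ k → Graph
C k 3≤k = record
  { V          = Fin k
  ; order      = k
  ; enum       = ↔-refl
  ; Adj        = λ u v → CyclicSuc u v ⊎ CyclicSuc v u
  ; Adj?       = λ u v → cyclicSuc? u v ⊎-dec cyclicSuc? v u
  ; Adj-sym    = swap
  ; Adj-irrefl = λ { refl (inj₁ s) → irrefl _ s ; refl (inj₂ s) → irrefl _ s }
  }
  where
  cyclicSuc? : ∀ (u v : Fin k) → Dec (CyclicSuc u v)
  cyclicSuc? u v = (toℕ v ℕₚ.≟ suc (toℕ u)) ⊎-dec
    ((suc (toℕ u) ℕₚ.≟ k) ×-dec (toℕ v ℕₚ.≟ 0))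

  irrefl : ∀ (u : Fin k) → ¬ CyclicSuc u u
  irrefl u (inj₁ eq)       = ℕₚ.1+n≢n (sym eq)
  irrefl u (inj₂ (eq , z)) with subst (3 ≤_) (trans (sym eq) (cong suc z)) 3≤k
  ... | s≤s ()

{-# OPTIONS --safe #-}
-- The lower bound holds because S_G^n contains copies of G.  For the upper bound,
-- colour a word by its last letter: the only conflicts are between w i j^(r-1) i and
-- w j i^r, and spending one new colour on all words whose last two letters agree
-- resolves them.
-- With |G| colours one can do without the new colour: the weighted letter sum modulo
-- |G| with weights 2^(n-2), ..., 2, 1, 1 is constant across every edge joining two
-- copies of G and injective on each copy; this settles K_p and C_3.
-- For C_k with k ≥ 5 the word w i j gets the colour c(j - i), where c is a 3-colouring
-- of the cycle which around 0 reads p p z q q; and C_k has no 2-colouring when 4 ∤ k,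
-- as such a colouring is 4-periodic around the cycle.  When 4 ∣ k the cycle is
-- 2-colourable, but S_{C_k}^n with n ≥ 2 has a vertex of degree 3.
module Submission where

open import Defs
open import Data.Empty using (⊥-elim)
open import Data.Fin using (Fin; zero; suc; toℕ; fromℕ; inject₁; inject≤)
import Data.Fin.Properties as Finₚ
open import Data.Nat using (ℕ; zero; suc; _+_; _*_; _^_; _∸_; _≤_; _<_; _<?_; _≤?_; _%_; _/_; z≤n; s≤s; NonZero)
open import Data.Nat.DivMod using (_mod_; m%n<n; m%n%n≡m%n; n%n≡0; m<n⇒m%n≡m; %-distribˡ-+; [m+n]%n≡m%n; [m+kn]%n≡m%n; m≡m%n+[m/n]*n)
open import Data.Nat.Properties hiding (_<?_; _≤?_)
open import Data.Nat.Tactic.RingSolver using (solve-∀)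
open import Data.Product using (_×_; _,_; proj₁; proj₂; ∃-syntax)
open import Data.Sum using (_⊎_; inj₁; inj₂)
open import Data.Vec using (Vec; []; _∷_; lookup; replicate)
open import Data.Vec.Properties using (lookup-replicate; ∷-injectiveˡ; ∷-injectiveʳ)
open import Function using (_∘_)
open import Relation.Binary.PropositionalEquality
open import Relation.Nullary using (yes; no; contradiction)
open ≡-Reasoning

open Graph using (V; Adj; Adj-sym; Adj-irrefl)

-- Adjacency in the generalized Sierpiński graph

-- Adjacency by recursion on the words instead of through the position `d`: `cross` has `d` at the
-- first letter, `within` strips a common first letter. The tails in `cross` are constrained by
-- equations, so matching on an edge need not unify an index with `replicate`.
data Edge (G : Graph) : ∀ {n} → Vec (V G) n → Vec (V G) n → Set where
  cross  : ∀ {n a b} {u v : Vec (V G) n} → Adj G a b →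
           u ≡ replicate n b → v ≡ replicate n a → Edge G (a ∷ u) (b ∷ v)
  within : ∀ {n a} {u v : Vec (V G) n} → Edge G u v → Edge G (a ∷ u) (a ∷ v)

constant⇒replicate : ∀ {A : Set} {n} (u : Vec A n) (b : A) →
                     (∀ i → lookup u i ≡ b) → u ≡ replicate n b
constant⇒replicate []      b eq = refl
constant⇒replicate (a ∷ u) b eq = cong₂ _∷_ (eq zero) (constant⇒replicate u b (eq ∘ suc))

toEdge : ∀ G {n} (u v : Vec (V G) n) → SierpińskiAdj G n u v → Edge G u v
toEdge G (a ∷ u) (b ∷ v) (zero , _ , at , after) = cross at
  (constant⇒replicate u b (λ i → proj₁ (after (suc i) (s≤s z≤n))))
  (constant⇒replicate v a (λ i → proj₂ (after (suc i) (s≤s z≤n))))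
toEdge G (a ∷ u) (b ∷ v) (suc d , before , at , after) with before zero (s≤s z≤n)
... | refl = within (toEdge G u v
  (d , (λ i i<d → before (suc i) (s≤s i<d)) , at , (λ i d<i → after (suc i) (s≤s d<i))))

fromEdge : ∀ G {n} {u v : Vec (V G) n} → Edge G u v → SierpińskiAdj G n u v
fromEdge G (cross {n} {a} {b} ab refl refl) = zero , (λ _ ()) , ab ,
  λ { (suc i) _ → lookup-replicate i b , lookup-replicate i a }
fromEdge G (within e) with fromEdge G e
... | d , before , at , after = suc d ,
  (λ { zero _ → refl ; (suc i) (s≤s i<d) → before i i<d }) , at ,
  (λ { (suc i) (s≤s d<i) → after i d<i })

-- Injective colourings are the maps injective on every neighbourhood. With both edges issuing from
-- `z`, conflicts can be sorted by the shapes of the two edges.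
edges⇒coloring : ∀ G n {k} (f : Vec (V G) n → Fin k) →
  (∀ z x y → Edge G z x → Edge G z y → x ≢ y → f x ≢ f y) →
  IsInjectiveColoring (Sierpiński G n) f
edges⇒coloring G n f ok x y x≢y eq (z , xz , yz) =
  ok z x y (toEdge G z x (Adj-sym S {x} {z} xz)) (toEdge G z y (Adj-sym S {y} {z} yz)) x≢y eq
  where S = Sierpiński G n

-- Injective colorings

χᵢ-≤ : ∀ H {k} → InjectivelyColorable H k → χᵢ H ≤ k
χᵢ-≤ H {k} = proj₂ (χᵢ-isLeast H) k

χᵢ-colorable : ∀ H → InjectivelyColorable H (χᵢ H)
χᵢ-colorable H = proj₁ (χᵢ-isLeast H)

colorable-mono : ∀ H {j k} → j ≤ k → InjectivelyColorable H j → InjectivelyColorable H k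
colorable-mono H j≤k (f , ok) = (λ v → inject≤ (f v) j≤k) ,
  λ u w u≢w eq → ok u w u≢w (Finₚ.inject≤-injective j≤k j≤k (f u) (f w) eq)

-- The neighbours of `z` have `z` as a common neighbour, so their colours are pairwise distinct.
degree≤colors : ∀ H {k d} → InjectivelyColorable H k → (z : V H) (x : Fin d → V H) →
  (∀ i → Adj H (x i) z) → (∀ i j → i ≢ j → x i ≢ x j) → d ≤ k
degree≤colors H (f , ok) z x adj distinct = Finₚ.injective⇒≤ {f = f ∘ x} inj
  where
  inj : ∀ {i j} → f (x i) ≡ f (x j) → i ≡ j
  inj {i} {j} eq with i Finₚ.≟ j
  ... | yes i≡j = i≡j
  ... | no  i≢j = contradiction (z , adj i , adj j) (ok (x i) (x j) (distinct i j i≢j) eq)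

-- Prefixing the letter `a` embeds the smaller graph into the larger one, and common neighbours stay
-- common, so the colouring restricts.
colorable-tail : ∀ G n {k} → V G →
  InjectivelyColorable (Sierpiński G (suc n)) k → InjectivelyColorable (Sierpiński G n) k
colorable-tail G n a (f , ok) = (λ v → f (a ∷ v)) ,
  λ u w u≢w eq (x , ux , wx) → ok (a ∷ u) (a ∷ w) (u≢w ∘ ∷-injectiveʳ) eq
    (a ∷ x , fromEdge G (within (toEdge G u x ux)) , fromEdge G (within (toEdge G w x wx)))

colorable-drop : ∀ G m n {k} → V G →
  InjectivelyColorable (Sierpiński G (m + n)) k → InjectivelyColorable (Sierpiński G n) k
colorable-drop G zero    n a = λ c → c
colorable-drop G (suc m) n a = colorable-drop G m n a ∘ colorable-tail G (m + n) a

colorable-base : ∀ G {k} →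
  InjectivelyColorable (Sierpiński G 1) k → InjectivelyColorable G k
colorable-base G (f , ok) = (λ v → f (v ∷ [])) ,
  λ u w u≢w eq (x , ux , wx) → ok (u ∷ []) (w ∷ []) (u≢w ∘ ∷-injectiveˡ) eq
    (x ∷ [] , fromEdge G (cross ux refl refl) , fromEdge G (cross wx refl refl))

colorable-of-Sierpiński : ∀ G n {k} →
  InjectivelyColorable (Sierpiński G (suc n)) k → InjectivelyColorable G k
colorable-of-Sierpiński G n {k} c with Graph.anyV? G {λ v → v ≡ v} (λ _ → yes refl)
-- A letter is needed as prefix; the trivial predicate decides whether `G` has a vertex at all, and
-- the empty graph is coloured vacuously.
... | yes (a , _) = colorable-base G (colorable-drop G n 1 a
        (subst (λ m → InjectivelyColorable (Sierpiński G m) k) (+-comm 1 n) c))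
... | no empty = (λ v → ⊥-elim (empty (v , refl))) , λ v _ _ _ _ → empty (v , refl)

χᵢ-lower : ∀ G n → 1 ≤ n → χᵢ G ≤ χᵢ (Sierpiński G n)
χᵢ-lower G (suc n) _ =
  χᵢ-≤ G (colorable-of-Sierpiński G n (χᵢ-colorable (Sierpiński G (suc n))))

-- Colorings determined by the last two letters

lastTwo : ∀ {A B : Set} {n} → (A → B) → (A → A → B) → Vec A (suc n) → B
lastTwo f g (a ∷ [])            = f a
lastTwo f g (a ∷ b ∷ [])        = g a b
lastTwo f g (a ∷ w@(_ ∷ _ ∷ _)) = lastTwo f g w

lastTwo-replicate : ∀ {A B : Set} (f : A → B) (g : A → A → B) n b a →
                    lastTwo f g (b ∷ replicate (2 + n) a) ≡ g a a
lastTwo-replicate f g zero    b a = refl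
lastTwo-replicate f g (suc n) b a = lastTwo-replicate f g n a a

-- A constant word can change only in its last letter: a crossing edge at an earlier position would
-- make the next letter equal to both ends of an edge of `G`.
lastTwo-extreme : ∀ G {B : Set} (f : V G → B) (g : V G → V G → B) n b y →
  Edge G (replicate (2 + n) b) y → ∃[ u ] Adj G b u × lastTwo f g y ≡ g b u
lastTwo-extreme G f g n b (_ ∷ _) (cross bc eq _) =
  ⊥-elim (Adj-irrefl G (∷-injectiveˡ eq) bc)
lastTwo-extreme G f g zero b (_ ∷ u ∷ []) (within (cross bu _ _)) = u , bu , refl
lastTwo-extreme G f g (suc n) b (_ ∷ y@(_ ∷ _ ∷ _)) (within e) = lastTwo-extreme G f g n b y e

-- A vertex has at most one neighbour outside its copy of `G`. Two neighbours inside the copy are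
-- separated by `f` or `g a`. For one outside and one inside: around `w a b` they are `w b a` and
-- `w a u`, which is `across`; around `w a b…b` with at least two `b` they end in `a a` and `b u`,
-- which is `extreme`.
lastTwo-coloring : ∀ G {k} (f : V G → Fin k) (g : V G → V G → Fin k) →
  IsInjectiveColoring G f →
  (∀ a → IsInjectiveColoring G (g a)) →
  (∀ a b u → Adj G a b → Adj G b u → g b a ≢ g a u) →
  (∀ i j u → Adj G j u → g i i ≢ g j u) →
  ∀ n → IsInjectiveColoring (Sierpiński G (suc n)) (lastTwo f g)
lastTwo-coloring G {k} f g f-ok g-ok across extreme n = edges⇒coloring G (suc n) (lastTwo f g) (ok n)
  where
  col : ∀ {n} → Vec (V G) (suc n) → Fin k
  col = lastTwo f g

  cross-within : ∀ {a b} m y → Adj G a b → Edge G (replicate (suc m) b) y →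
                 col (b ∷ replicate (suc m) a) ≢ col (a ∷ y)
  cross-within zero (u ∷ []) ab (cross bu _ _) = across _ _ u ab bu
  cross-within {a} {b} (suc m) y@(_ ∷ _ ∷ _) ab e eq with lastTwo-extreme G f g m b y e
  ... | u , bu , col-y =
    extreme a b u bu (trans (sym (lastTwo-replicate f g m b a)) (trans eq col-y))

  ok : ∀ n z x y → Edge G {suc n} z x → Edge G z y → x ≢ y → col x ≢ col y
  ok zero (c ∷ []) (a ∷ []) (b ∷ []) (cross ca _ _) (cross cb _ _) x≢y eq =
    f-ok a b (x≢y ∘ cong (_∷ [])) eq (c , Adj-sym G ca , Adj-sym G cb)
  -- Two crossing edges at the first letter coincide, since the second letter of the word determines
  -- where they lead.
  ok (suc n) (_ ∷ _) _ _ (cross ca refl refl) (cross cb eq refl) x≢y _ =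
    x≢y (cong (_∷ _) (∷-injectiveˡ eq))
  ok (suc n) _ _ (_ ∷ y) (cross ca refl refl) (within e) _ eq = cross-within n y ca e eq
  ok (suc n) _ (_ ∷ x) _ (within e) (cross cb refl refl) _ eq = cross-within n x cb e (sym eq)
  ok (suc zero) (c ∷ z ∷ []) (_ ∷ a ∷ []) (_ ∷ b ∷ [])
     (within (cross za _ _)) (within (cross zb _ _)) x≢y eq =
    g-ok c a b (x≢y ∘ cong (λ v → c ∷ v ∷ [])) eq (z , Adj-sym G za , Adj-sym G zb)
  ok (suc (suc n)) (c ∷ z) (_ ∷ x@(_ ∷ _ ∷ _)) (_ ∷ y@(_ ∷ _ ∷ _))
     (within e) (within e′) x≢y eq = ok (suc n) z x y e e′ (x≢y ∘ cong (c ∷_)) eq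

colorable-suc : ∀ G n {k} → InjectivelyColorable G k →
                InjectivelyColorable (Sierpiński G (suc n)) (suc k)
colorable-suc G n {k} (f , ok) = lastTwo f⁺ g ,
  lastTwo-coloring G f⁺ g f⁺-ok g-ok across extreme n
  where
  open Graph G using (_≟ⱽ_)

  f⁺ : V G → Fin (suc k)
  f⁺ v = suc (f v)

  f⁺-ok : IsInjectiveColoring G f⁺
  f⁺-ok u w u≢w eq = ok u w u≢w (Finₚ.suc-injective eq)

  g : V G → V G → Fin (suc k)
  g a b with a ≟ⱽ b
  ... | yes _ = zero
  ... | no  _ = f⁺ b

  g-≢ : ∀ {a b} → a ≢ b → g a b ≡ f⁺ b
  g-≢ {a} {b} a≢b with a ≟ⱽ b
  ... | yes a≡b = contradiction a≡b a≢b
  ... | no  _   = refl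

  g-≡ : ∀ a → g a a ≡ zero
  g-≡ a with a ≟ⱽ a
  ... | yes _   = refl
  ... | no  a≢a = contradiction refl a≢a

  adj⇒≢ : ∀ {a b} → Adj G a b → a ≢ b
  adj⇒≢ ab a≡b = Adj-irrefl G a≡b ab

  g-ok : ∀ a → IsInjectiveColoring G (g a)
  g-ok a u w u≢w eq common with a ≟ⱽ u | a ≟ⱽ w
  ... | yes a≡u | yes a≡w = u≢w (trans (sym a≡u) a≡w)
  ... | no  _   | no  _   = f⁺-ok u w u≢w eq common
  g-ok a u w u≢w () common | yes _ | no _
  g-ok a u w u≢w () common | no _ | yes _

  across : ∀ a b u → Adj G a b → Adj G b u → g b a ≢ g a u
  -- `a` and `u` share the neighbour `b`, so their old colours differ unless `u` is `a`, and then
  -- `g a u` is the new colour.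
  across a b u ab bu eq with a ≟ⱽ u
  ... | yes _   = contradiction (trans (sym (g-≢ (adj⇒≢ (Adj-sym G ab)))) eq) λ ()
  ... | no  a≢u = f⁺-ok a u a≢u (trans (sym (g-≢ (adj⇒≢ (Adj-sym G ab)))) eq)
                    (b , ab , Adj-sym G bu)

  extreme : ∀ i j u → Adj G j u → g i i ≢ g j u
  extreme i j u ju eq =
    contradiction (trans (sym (g-≡ i)) (trans eq (g-≢ (adj⇒≢ ju)))) λ ()

χᵢ-upper : ∀ G n → 1 ≤ n → χᵢ (Sierpiński G n) ≤ χᵢ G + 1
χᵢ-upper G (suc n) _ = subst (χᵢ (Sierpiński G (suc n)) ≤_) (+-comm 1 (χᵢ G))
  (χᵢ-≤ (Sierpiński G (suc n)) (colorable-suc G n (χᵢ-colorable G)))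

-- Colorings by a weighted sum of letters

-- With `p = 1 + q`, the number `a * q` is an additive inverse of `a` modulo `p`.
+-cancelˡ-% : ∀ a s t p .{{_ : NonZero p}} → (a + s) % p ≡ (a + t) % p → s % p ≡ t % p
+-cancelˡ-% a s t p@(suc q) eq =
  trans (sym (unshift s)) (trans (cong (λ r → (a * q % p + r) % p) eq) (unshift t))
  where
  regroup : ∀ a q s → a * q + (a + s) ≡ s + a * (1 + q)
  regroup = solve-∀

  unshift : ∀ s → (a * q % p + (a + s) % p) % p ≡ s % p
  unshift s = begin
    (a * q % p + (a + s) % p) % p  ≡⟨ %-distribˡ-+ (a * q) (a + s) p ⟨
    (a * q + (a + s)) % p          ≡⟨ cong (_% p) (regroup a q s) ⟩
    (s + a * p) % p                ≡⟨ [m+kn]%n≡m%n s a p ⟩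
    s % p                          ∎

-- Every letter but the last weighs as much as all later letters together. This balance makes the
-- sum invariant when a letter is exchanged with the constant tail after it.
weight : ∀ G {n} → Vec (V G) (suc n) → ℕ
weight G         (a ∷ [])        = toℕ (Graph.index G a)
weight G {suc n} (a ∷ w@(_ ∷ _)) = 2 ^ n * toℕ (Graph.index G a) + weight G w

weight-replicate : ∀ G n a →
  weight G (replicate (suc n) a) ≡ 2 ^ n * toℕ (Graph.index G a)
weight-replicate G zero    a = sym (+-identityʳ _)
weight-replicate G (suc n) a = begin
  2 ^ n * ⟦a⟧ + weight G (replicate (suc n) a)  ≡⟨ cong (2 ^ n * ⟦a⟧ +_) (weight-replicate G n a) ⟩
  2 ^ n * ⟦a⟧ + 2 ^ n * ⟦a⟧                     ≡⟨ double (2 ^ n) ⟦a⟧ ⟩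
  2 ^ suc n * ⟦a⟧                               ∎
  where
  ⟦a⟧ = toℕ (Graph.index G a)

  double : ∀ x y → x * y + x * y ≡ 2 * x * y
  double = solve-∀

weight-cross : ∀ G n a b →
  weight G (b ∷ replicate (suc n) a) ≡ weight G (a ∷ replicate (suc n) b)
weight-cross G n a b = begin
  2 ^ n * ⟦b⟧ + weight G (replicate (suc n) a)  ≡⟨ cong (2 ^ n * ⟦b⟧ +_) (weight-replicate G n a) ⟩
  2 ^ n * ⟦b⟧ + 2 ^ n * ⟦a⟧                     ≡⟨ +-comm (2 ^ n * ⟦b⟧) _ ⟩
  2 ^ n * ⟦a⟧ + 2 ^ n * ⟦b⟧                     ≡⟨ cong (2 ^ n * ⟦a⟧ +_) (weight-replicate G n b) ⟨
  2 ^ n * ⟦a⟧ + weight G (replicate (suc n) b)  ∎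
  where
  ⟦a⟧ = toℕ (Graph.index G a)
  ⟦b⟧ = toℕ (Graph.index G b)

letter-injective-% : ∀ G .{{_ : NonZero (Graph.order G)}} {a b} →
  toℕ (Graph.index G a) % Graph.order G ≡ toℕ (Graph.index G b) % Graph.order G → a ≡ b
letter-injective-% G {a} {b} eq = begin
  a                   ≡⟨ vertex∘index a ⟨
  vertex (index a)    ≡⟨ cong vertex (Finₚ.toℕ-injective (trans (sym (reduce a)) (trans eq (reduce b)))) ⟩
  vertex (index b)    ≡⟨ vertex∘index b ⟩
  b                   ∎
  where
  open Graph G using (order; index; vertex; vertex∘index)
  reduce : ∀ c → toℕ (index c) % order ≡ toℕ (index c)
  reduce c = m<n⇒m%n≡m (Finₚ.toℕ<n (index c))

-- A neighbour reached by a crossing edge has the weight of the vertex itself, so it is that vertex,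
-- with its constant tail, which has to be told apart from its neighbours inside the copy. These
-- differ from it only in the last letter, of weight 1.
weight-extreme : ∀ G .{{_ : NonZero (Graph.order G)}} n b y → Edge G (replicate (suc n) b) y →
  weight G (replicate (suc n) b) % Graph.order G ≢ weight G y % Graph.order G
weight-extreme G zero b (c ∷ []) (cross bc _ _) eq = Adj-irrefl G (letter-injective-% G eq) bc
weight-extreme G (suc n) b _ (cross bc b≡c _) _ = Adj-irrefl G (∷-injectiveˡ b≡c) bc
weight-extreme G (suc n) b (_ ∷ y@(_ ∷ _)) (within e) eq =
  weight-extreme G n b y e (+-cancelˡ-% (2 ^ n * toℕ (Graph.index G b)) _ _ (Graph.order G) eq)

weight-distinct : ∀ G .{{_ : NonZero (Graph.order G)}} n z x y →
  Edge G {suc n} z x → Edge G z y → x ≢ y →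
  weight G x % Graph.order G ≢ weight G y % Graph.order G
weight-distinct G zero (c ∷ []) (a ∷ []) (b ∷ []) (cross _ _ _) (cross _ _ _) x≢y eq =
  x≢y (cong (_∷ []) (letter-injective-% G eq))
weight-distinct G (suc n) _ _ _ (cross ca refl refl) (cross cb eq refl) x≢y _ =
  x≢y (cong (_∷ _) (∷-injectiveˡ eq))
weight-distinct G (suc n) (a ∷ z) (b ∷ _) (_ ∷ y@(_ ∷ _)) (cross ab refl refl) (within e) _ eq =
  weight-extreme G n b y e (+-cancelˡ-% (2 ^ n * toℕ (Graph.index G a)) _ _ (Graph.order G)
    (trans (cong (_% Graph.order G) (sym (weight-cross G n a b))) eq))
weight-distinct G (suc n) (a ∷ z) (_ ∷ x@(_ ∷ _)) (b ∷ _) (within e) (cross ab refl refl) _ eq =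
  weight-extreme G n b x e (+-cancelˡ-% (2 ^ n * toℕ (Graph.index G a)) _ _ (Graph.order G)
    (trans (cong (_% Graph.order G) (sym (weight-cross G n a b))) (sym eq)))
weight-distinct G (suc n) (a ∷ z) (_ ∷ x@(_ ∷ _)) (_ ∷ y@(_ ∷ _)) (within e) (within e′) x≢y eq =
  weight-distinct G n z x y e e′ (x≢y ∘ cong (a ∷_))
    (+-cancelˡ-% (2 ^ n * toℕ (Graph.index G a)) _ _ (Graph.order G) eq)

toℕ-mod : ∀ m k .{{_ : NonZero k}} → toℕ (m mod k) ≡ m % k
toℕ-mod m k = Finₚ.toℕ-fromℕ< (m%n<n m k)

order-colorable-Sierpiński : ∀ G .{{_ : NonZero (Graph.order G)}} n →
  InjectivelyColorable (Sierpiński G (suc n)) (Graph.order G)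
order-colorable-Sierpiński G n = (λ w → weight G w mod Graph.order G) ,
  edges⇒coloring G (suc n) _ λ z x y zx zy x≢y eq → weight-distinct G n z x y zx zy x≢y
    (trans (sym (toℕ-mod (weight G x) (Graph.order G))) (trans (cong toℕ eq) (toℕ-mod (weight G y) (Graph.order G))))

-- Cycles

CyclicSuc-unique : ∀ {k} {u v w : Fin k} → CyclicSuc u v → CyclicSuc u w → v ≡ w
CyclicSuc-unique (inj₁ p) (inj₁ q) = Finₚ.toℕ-injective (trans p (sym q))
CyclicSuc-unique {v = v} (inj₁ p) (inj₂ (q , _)) = contradiction (trans p q) (<⇒≢ (Finₚ.toℕ<n v))
CyclicSuc-unique {w = w} (inj₂ (p , _)) (inj₁ q) = contradiction (trans q p) (<⇒≢ (Finₚ.toℕ<n w))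
CyclicSuc-unique (inj₂ (_ , p)) (inj₂ (_ , q)) = Finₚ.toℕ-injective (trans p (sym q))

CyclicPred-unique : ∀ {k} {u w v : Fin k} → CyclicSuc u v → CyclicSuc w v → u ≡ w
CyclicPred-unique (inj₁ p) (inj₁ q) = Finₚ.toℕ-injective (suc-injective (trans (sym p) q))
CyclicPred-unique (inj₁ p) (inj₂ (_ , q)) = contradiction (trans (sym p) q) λ ()
CyclicPred-unique (inj₂ (_ , p)) (inj₁ q) = contradiction (trans (sym q) p) λ ()
CyclicPred-unique (inj₂ (p , _)) (inj₂ (q , _)) =
  Finₚ.toℕ-injective (suc-injective (trans p (sym q)))

-- Reducing the naturals modulo `k` walks around the cycle forever, which turns a colouring of the
-- cycle into a `k`-periodic sequence.
CyclicSuc-mod : ∀ n k .{{_ : NonZero k}} → CyclicSuc (n mod k) (suc n mod k)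
CyclicSuc-mod n k = step (m≤n⇒m<n∨m≡n (m%n<n n k))
  where
  suc-% : suc n % k ≡ suc (n % k) % k
  suc-% = begin
    suc n % k                  ≡⟨ %-distribˡ-+ 1 n k ⟩
    (1 % k + n % k) % k        ≡⟨ cong (λ r → (1 % k + r) % k) (m%n%n≡m%n n k) ⟨
    (1 % k + n % k % k) % k    ≡⟨ %-distribˡ-+ 1 (n % k) k ⟨
    suc (n % k) % k            ∎

  step : suc (n % k) < k ⊎ suc (n % k) ≡ k → CyclicSuc (n mod k) (suc n mod k)
  step (inj₁ lt) = inj₁ (begin
    toℕ (suc n mod k)    ≡⟨ toℕ-mod (suc n) k ⟩
    suc n % k            ≡⟨ suc-% ⟩
    suc (n % k) % k      ≡⟨ m<n⇒m%n≡m lt ⟩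
    suc (n % k)          ≡⟨ cong suc (toℕ-mod n k) ⟨
    suc (toℕ (n mod k))  ∎)
  step (inj₂ eq) = inj₂ (trans (cong suc (toℕ-mod n k)) eq , (begin
    toℕ (suc n mod k)    ≡⟨ toℕ-mod (suc n) k ⟩
    suc n % k            ≡⟨ suc-% ⟩
    suc (n % k) % k      ≡⟨ cong (_% k) eq ⟩
    k % k                ≡⟨ n%n≡0 k ⟩
    0                    ∎))

mod-cong : ∀ {m n} k .{{_ : NonZero k}} → m % k ≡ n % k → m mod k ≡ n mod k
mod-cong {m} {n} k eq = Finₚ.toℕ-injective (trans (toℕ-mod m k) (trans eq (sym (toℕ-mod n k))))

+-mod : ∀ k n .{{_ : NonZero k}} → (k + n) mod k ≡ n mod k
+-mod k n = mod-cong k (trans (cong (_% k) (+-comm k n)) ([m+n]%n≡m%n n k))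

-- On a cycle, distinct vertices with a common neighbour are its predecessor and its successor.
distance-two-coloring : ∀ k 3≤k {j} (f : Fin k → Fin j) →
  (∀ u x w → CyclicSuc u x → CyclicSuc x w → f u ≢ f w) → IsInjectiveColoring (C k 3≤k) f
distance-two-coloring k 3≤k f ok u w u≢w eq (x , inj₁ ux , inj₁ wx) = u≢w (CyclicPred-unique ux wx)
distance-two-coloring k 3≤k f ok u w u≢w eq (x , inj₁ ux , inj₂ xw) = ok u x w ux xw eq
distance-two-coloring k 3≤k f ok u w u≢w eq (x , inj₂ xu , inj₁ wx) = ok w x u wx xu (sym eq)
distance-two-coloring k 3≤k f ok u w u≢w eq (x , inj₂ xu , inj₂ xw) = u≢w (CyclicSuc-unique xu xw)

coloring-distance-two : ∀ k 3≤k .{{_ : NonZero k}} {j} (f : Fin k → Fin j) →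
  IsInjectiveColoring (C k 3≤k) f → ∀ n → f (n mod k) ≢ f ((2 + n) mod k)
coloring-distance-two k 3≤k f ok n eq = ok (n mod k) ((2 + n) mod k) distinct eq
  (suc n mod k , inj₁ (CyclicSuc-mod n k) , inj₂ (CyclicSuc-mod (suc n) k))
  where
  distinct : n mod k ≢ (2 + n) mod k
  -- From `3 ≤ k`, the residues 0 and 2 differ, so two steps never return to the start.
  distinct same = contradiction (begin
    0      ≡⟨ m<n⇒m%n≡m (≤-trans (s≤s z≤n) 3≤k) ⟨
    0 % k  ≡⟨ +-cancelˡ-% n 0 2 k (begin
      (n + 0) % k          ≡⟨ cong (_% k) (+-identityʳ n) ⟩
      n % k                ≡⟨ toℕ-mod n k ⟨
      toℕ (n mod k)        ≡⟨ cong toℕ same ⟩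
      toℕ ((2 + n) mod k)  ≡⟨ toℕ-mod (2 + n) k ⟩
      (2 + n) % k          ≡⟨ cong (_% k) (+-comm 2 n) ⟩
      (n + 2) % k          ∎) ⟩
    2 % k  ≡⟨ m<n⇒m%n≡m 3≤k ⟩
    2      ∎) λ ()

-- Colourings of cycles with two and three colours

≢-≢⇒≡ : ∀ {a b c : Fin 2} → a ≢ b → b ≢ c → a ≡ c
≢-≢⇒≡ {zero}     {zero}     a≢b b≢c = contradiction refl a≢b
≢-≢⇒≡ {zero}     {suc zero} {zero}     a≢b b≢c = refl
≢-≢⇒≡ {zero}     {suc zero} {suc zero} a≢b b≢c = contradiction refl b≢c
≢-≢⇒≡ {suc zero} {zero}     {zero}     a≢b b≢c = contradiction refl b≢c
≢-≢⇒≡ {suc zero} {zero}     {suc zero} a≢b b≢c = refl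
≢-≢⇒≡ {suc zero} {suc zero} a≢b b≢c = contradiction refl a≢b

-- With two colours, differing at distance two forces equality at distance four. Hence `k % 4` is a
-- period as well, and each of the periods 1, 2 and 3 would equate two terms at distance two.
period⇒4∣ : (F : ℕ → Fin 2) → (∀ n → F n ≢ F (2 + n)) →
            ∀ k → (∀ n → F (k + n) ≡ F n) → k % 4 ≡ 0
period⇒4∣ F alternates k periodic = remainder (k % 4) (m%n<n k 4) reduced
  where
  four : ∀ n → F (4 + n) ≡ F n
  four n = sym (≢-≢⇒≡ (alternates n) (alternates (2 + n)))

  fours : ∀ q n → F (q * 4 + n) ≡ F n
  fours zero    n = refl
  fours (suc q) n = trans (four (q * 4 + n)) (fours q n)

  rearrange : ∀ q r n → q + (r + n) ≡ (r + q) + n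
  rearrange = solve-∀

  reduced : ∀ n → F (k % 4 + n) ≡ F n
  reduced n = begin
    F (k % 4 + n)                      ≡⟨ fours (k / 4) (k % 4 + n) ⟨
    F (k / 4 * 4 + (k % 4 + n))        ≡⟨ cong F (rearrange (k / 4 * 4) (k % 4) n) ⟩
    F ((k % 4 + k / 4 * 4) + n)        ≡⟨ cong (λ m → F (m + n)) (m≡m%n+[m/n]*n k 4) ⟨
    F (k + n)                          ≡⟨ periodic n ⟩
    F n                                ∎

  remainder : ∀ r → r < 4 → (∀ n → F (r + n) ≡ F n) → r ≡ 0
  remainder 0 _ _ = refl
  remainder 1 _ per = ⊥-elim (alternates 0 (sym (trans (per 1) (per 0))))
  remainder 2 _ per = ⊥-elim (alternates 0 (sym (per 0)))
  remainder 3 _ per = ⊥-elim (alternates 0 (begin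
    F 0  ≡⟨ per 0 ⟨
    F 3  ≡⟨ per 3 ⟨
    F 6  ≡⟨ four 2 ⟩
    F 2  ∎))
  remainder (suc (suc (suc (suc r)))) (s≤s (s≤s (s≤s (s≤s ())))) _

C-colors-≥3 : ∀ k 3≤k → k % 4 ≢ 0 → ∀ {j} → InjectivelyColorable (C k 3≤k) j → 3 ≤ j
C-colors-≥3 k@(suc _) 3≤k k%4≢0 {j} col with 3 ≤? j
... | yes 3≤j = 3≤j
... | no  3≰j with colorable-mono (C k 3≤k) (≤-pred (≰⇒> 3≰j)) col
...   | f , ok = contradiction
        (period⇒4∣ (λ n → f (n mod k)) (coloring-distance-two k 3≤k f ok) k
          (λ n → cong f (+-mod k n)))
        k%4≢0

-- The 4-periodic pattern z q q z; hue puts a third colour p on the last two vertices.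
tint : ℕ → Fin 2
tint 0 = zero
tint 1 = suc zero
tint 2 = suc zero
tint 3 = zero
tint (suc (suc (suc (suc n)))) = tint n

tint-alternates : ∀ n → tint n ≢ tint (2 + n)
tint-alternates 0 ()
tint-alternates 1 ()
tint-alternates 2 ()
tint-alternates 3 ()
tint-alternates (suc (suc (suc (suc n)))) = tint-alternates n

tint-periodic : ∀ q n → tint (q * 4 + n) ≡ tint n
tint-periodic zero    n = refl
tint-periodic (suc q) n = tint-periodic q n

C-2-colorable : ∀ k 3≤k → k % 4 ≡ 0 → InjectivelyColorable (C k 3≤k) 2
C-2-colorable k 3≤k k%4≡0 = tint ∘ toℕ , distance-two-coloring k 3≤k (tint ∘ toℕ) ok
  where
  period : ∀ n → tint (k + n) ≡ tint n
  period n = begin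
    tint (k + n)                  ≡⟨ cong (λ m → tint (m + n)) (m≡m%n+[m/n]*n k 4) ⟩
    tint (k % 4 + k / 4 * 4 + n)  ≡⟨ cong (λ r → tint (r + k / 4 * 4 + n)) k%4≡0 ⟩
    tint (k / 4 * 4 + n)          ≡⟨ tint-periodic (k / 4) n ⟩
    tint n                        ∎

  -- At the seam the second vertex after `u` is `k + n` with `n` equal to 0 or 1; by 4-periodicity
  -- the pattern continues past `k` unchanged.
  wrap : ∀ n u w → 2 + toℕ u ≡ k + n → toℕ w ≡ n → tint (toℕ u) ≢ tint (toℕ {k} w)
  wrap n u w 2+u≡k+n w≡n eq = tint-alternates (toℕ {k} u)
    (trans eq (trans (cong tint w≡n) (sym (trans (cong tint 2+u≡k+n) (period n)))))

  ok : ∀ u x w → CyclicSuc u x → CyclicSuc x w → tint (toℕ u) ≢ tint (toℕ {k} w)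
  ok u x w (inj₁ x≡1+u) (inj₁ w≡1+x) eq =
    tint-alternates (toℕ u) (trans eq (cong tint (trans w≡1+x (cong suc x≡1+u))))
  ok u x w (inj₁ x≡1+u) (inj₂ (1+x≡k , w≡0)) = wrap 0 u w
    (trans (cong suc (sym x≡1+u)) (trans 1+x≡k (sym (+-identityʳ k)))) w≡0
  ok u x w (inj₂ (1+u≡k , x≡0)) (inj₁ w≡1+x) = wrap 1 u w
    (trans (cong suc 1+u≡k) (+-comm 1 k)) (trans w≡1+x (cong suc x≡0))
  ok u x w (inj₂ (1+u≡k , x≡0)) (inj₂ (1+x≡k , w≡0)) =
    contradiction (subst (3 ≤_) (trans (sym 1+x≡k) (cong suc x≡0)) 3≤k) λ { (s≤s ()) }

hue : ℕ → ℕ → Fin 3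
hue k j with 2 + j <? k
... | yes _ = inject₁ (tint j)
... | no  _ = fromℕ 2

hue-inner : ∀ {k j} → 2 + j < k → hue k j ≡ inject₁ (tint j)
hue-inner {k} {j} lt with 2 + j <? k
... | yes _  = refl
... | no  ≮k = contradiction lt ≮k

hue-outer : ∀ {k j} → k ≤ 2 + j → hue k j ≡ fromℕ 2
hue-outer {k} {j} k≤ with 2 + j <? k
... | yes <k = contradiction k≤ (<⇒≱ <k)
... | no  _  = refl

-- Inner vertices at distance two differ by `tint`. The two outer vertices are consecutive, so their
-- partners at distance two are inner; `4 ≤ k` ensures this for the vertices 0 and 1 after the seam.
hue-coloring : ∀ k 3≤k → 4 ≤ k → IsInjectiveColoring (C k 3≤k) (hue k ∘ toℕ)
hue-coloring k 3≤k 4≤k = distance-two-coloring k 3≤k (hue k ∘ toℕ) ok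
  where
  inner≢outer : ∀ {i j} → 2 + i < k → k ≤ 2 + j → hue k j ≢ hue k i
  inner≢outer i<k k≤j eq =
    Finₚ.fromℕ≢inject₁ (trans (sym (hue-outer k≤j)) (trans eq (hue-inner i<k)))

  step : ∀ i → 2 + i < k → hue k i ≢ hue k (2 + i)
  step i i<k eq with <-≤-connex (4 + i) k
  ... | inj₁ 2+i<k = tint-alternates i
          (Finₚ.inject₁-injective (trans (sym (hue-inner i<k)) (trans eq (hue-inner 2+i<k))))
  ... | inj₂ k≤2+i = inner≢outer i<k k≤2+i (sym eq)

  ok : ∀ u x w → CyclicSuc u x → CyclicSuc x w → hue k (toℕ u) ≢ hue k (toℕ {k} w)
  ok u x w (inj₁ x≡1+u) (inj₁ w≡1+x) eq =
    step (toℕ u) (subst (_< k) w≡2+u (Finₚ.toℕ<n w)) (trans eq (cong (hue k) w≡2+u))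
    where
    w≡2+u : toℕ w ≡ 2 + toℕ u
    w≡2+u = trans w≡1+x (cong suc x≡1+u)
  ok u x w (inj₁ x≡1+u) (inj₂ (1+x≡k , w≡0)) = inner≢outer
    (subst (λ i → 2 + i < k) (sym w≡0) 3≤k) (≤-reflexive (trans (sym 1+x≡k) (cong suc x≡1+u)))
  ok u x w (inj₂ (1+u≡k , x≡0)) (inj₁ w≡1+x) = inner≢outer
    (subst (λ i → 2 + i < k) (sym (trans w≡1+x (cong suc x≡0))) 4≤k)
    (≤-trans (≤-reflexive (sym 1+u≡k)) (n≤1+n _))
  ok u x w (inj₂ (1+u≡k , x≡0)) (inj₂ (1+x≡k , w≡0)) =
    contradiction (subst (3 ≤_) (trans (sym 1+x≡k) (cong suc x≡0)) 3≤k) λ { (s≤s ()) }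

-- Three colours for Sierpiński graphs over cycles of length at least 5

long-cycle-colorable : ∀ m 3≤k n → InjectivelyColorable (Sierpiński (C (5 + m) 3≤k) (suc n)) 3
long-cycle-colorable m 3≤k n =
  lastTwo c g , lastTwo-coloring (C k 3≤k) c g c-ok g-ok across extreme n
  where
  k : ℕ
  k = 5 + m

  c : Fin k → Fin 3
  c = hue k ∘ toℕ

  c-ok : IsInjectiveColoring (C k 3≤k) c
  c-ok = hue-coloring k 3≤k (s≤s (s≤s (s≤s (s≤s z≤n))))

  c-mod : ∀ {i} → i < k → c (i mod k) ≡ hue k i
  c-mod {i} i<k = cong (hue k) (trans (toℕ-mod i k) (m<n⇒m%n≡m i<k))

  -- The argument of `c` is `b − a` modulo `k`, written so that subtraction is never truncated. As
  -- `k` is at least 5, the offsets -2, ..., 2 are distinct residues and can carry the pattern p p z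
  -- q q.
  g : Fin k → Fin k → Fin 3
  g a b = c ((toℕ b + (k ∸ toℕ a)) mod k)

  -- Makes one step along the cycle count as `+ 1` in the offset even at the seam, where `toℕ b`
  -- drops to 0.
  suc-target : ∀ {a b} → CyclicSuc a b → ∀ t → (toℕ b + t) mod k ≡ (suc (toℕ a) + t) mod k
  suc-target (inj₁ b≡1+a) t = cong (λ i → (i + t) mod k) b≡1+a
  suc-target (inj₂ (1+a≡k , b≡0)) t = trans (cong (λ i → (i + t) mod k) b≡0)
    (sym (trans (cong (λ i → (i + t) mod k) 1+a≡k) (+-mod k t)))

  suc-source : ∀ {a b : Fin k} → CyclicSuc a b → ∀ t →
               (suc t + (k ∸ toℕ b)) mod k ≡ (t + (k ∸ toℕ a)) mod k
  suc-source {a} {b} (inj₁ b≡1+a) t = cong (_mod k) (begin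
    suc t + (k ∸ toℕ b)          ≡⟨ +-suc t (k ∸ toℕ b) ⟨
    t + suc (k ∸ toℕ b)          ≡⟨ cong (λ i → t + suc (k ∸ i)) b≡1+a ⟩
    t + (1 + (k ∸ suc (toℕ a)))  ≡⟨ cong (t +_) (+-∸-assoc 1 (Finₚ.toℕ<n a)) ⟨
    t + (k ∸ toℕ a)              ∎)
  suc-source {a} {b} (inj₂ (1+a≡k , b≡0)) t = begin
    (suc t + (k ∸ toℕ b)) mod k        ≡⟨ cong (λ i → (suc t + (k ∸ i)) mod k) b≡0 ⟩
    (suc t + k) mod k                  ≡⟨ cong (_mod k) (+-comm (suc t) k) ⟩
    (k + suc t) mod k                  ≡⟨ +-mod k (suc t) ⟩
    suc t mod k                        ≡⟨ cong (_mod k) (+-comm 1 t) ⟩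
    (t + 1) mod k                      ≡⟨ cong (λ i → (t + i) mod k) (m+n∸n≡m 1 (toℕ a)) ⟨
    (t + (suc (toℕ a) ∸ toℕ a)) mod k  ≡⟨ cong (λ i → (t + (i ∸ toℕ a)) mod k) 1+a≡k ⟩
    (t + (k ∸ toℕ a)) mod k            ∎

  offset : ∀ (a : Fin k) t → (t + toℕ a + (k ∸ toℕ a)) mod k ≡ t mod k
  offset a t = begin
    (t + toℕ a + (k ∸ toℕ a)) mod k    ≡⟨ cong (_mod k) (+-assoc t (toℕ a) (k ∸ toℕ a)) ⟩
    (t + (toℕ a + (k ∸ toℕ a))) mod k  ≡⟨ cong (λ i → (t + i) mod k) (m+[n∸m]≡n (<⇒≤ (Finₚ.toℕ<n a))) ⟩
    (t + k) mod k                      ≡⟨ cong (_mod k) (+-comm t k) ⟩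
    (k + t) mod k                      ≡⟨ +-mod k t ⟩
    t mod k                            ∎

  -- At offsets 0, 1 and 2 the colour comes out by evaluation, as `k` is `5 + m`; the offsets -1 and
  -- -2 involve `m` and go through `hue-outer`.
  at-0 : ∀ a → g a a ≡ zero
  at-0 a = cong c (offset a 0)

  at-1 : ∀ {a b} → CyclicSuc a b → g a b ≡ suc zero
  at-1 {a} {b} ab = cong c (trans (suc-target ab (k ∸ toℕ a)) (offset a 1))

  at-2 : ∀ {a b u} → CyclicSuc a b → CyclicSuc b u → g a u ≡ suc zero
  at-2 {a} {b} {u} ab bu = cong c (begin
    (toℕ u + (k ∸ toℕ a)) mod k        ≡⟨ suc-target bu (k ∸ toℕ a) ⟩
    (suc (toℕ b) + (k ∸ toℕ a)) mod k  ≡⟨ cong (_mod k) (+-suc (toℕ b) (k ∸ toℕ a)) ⟨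
    (toℕ b + suc (k ∸ toℕ a)) mod k    ≡⟨ suc-target ab (suc (k ∸ toℕ a)) ⟩
    (suc (toℕ a) + suc (k ∸ toℕ a)) mod k  ≡⟨ cong (_mod k) (+-suc (suc (toℕ a)) (k ∸ toℕ a)) ⟩
    (2 + toℕ a + (k ∸ toℕ a)) mod k    ≡⟨ offset a 2 ⟩
    2 mod k                            ∎)

  at-−1 : ∀ {a b} → CyclicSuc a b → g b a ≡ suc (suc zero)
  at-−1 {a} {b} ab = trans (cong c (begin
    -- Adding a full turn `k = suc (4 + m)` turns the offset -1 into the natural number `4 + m`.
    (toℕ a + (k ∸ toℕ b)) mod k              ≡⟨ +-mod k _ ⟨
    (k + (toℕ a + (k ∸ toℕ b))) mod k        ≡⟨ cong (_mod k) (+-assoc k (toℕ a) (k ∸ toℕ b)) ⟨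
    (suc (4 + m + toℕ a) + (k ∸ toℕ b)) mod k  ≡⟨ suc-source ab (4 + m + toℕ a) ⟩
    (4 + m + toℕ a + (k ∸ toℕ a)) mod k      ≡⟨ offset a (4 + m) ⟩
    (4 + m) mod k                            ∎))
    (trans (c-mod ≤-refl) (hue-outer (n≤1+n k)))

  at-−2 : ∀ {a b u} → CyclicSuc u b → CyclicSuc b a → g a u ≡ suc (suc zero)
  at-−2 {a} {b} {u} ub ba = trans (cong c (begin
    (toℕ u + (k ∸ toℕ a)) mod k              ≡⟨ +-mod k _ ⟨
    (k + (toℕ u + (k ∸ toℕ a))) mod k        ≡⟨ cong (_mod k) (+-assoc k (toℕ u) (k ∸ toℕ a)) ⟨
    (suc (4 + m + toℕ u) + (k ∸ toℕ a)) mod k  ≡⟨ suc-source ba (4 + m + toℕ u) ⟩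
    (suc (3 + m + toℕ u) + (k ∸ toℕ b)) mod k  ≡⟨ suc-source ub (3 + m + toℕ u) ⟩
    (3 + m + toℕ u + (k ∸ toℕ u)) mod k      ≡⟨ offset u (3 + m) ⟩
    (3 + m) mod k                            ∎))
    (trans (c-mod (n≤1+n (4 + m))) (hue-outer {k} {3 + m} ≤-refl))

  g-ok : ∀ a → IsInjectiveColoring (C k 3≤k) (g a)
  -- `g a` is the colouring `c` rotated by `a`, so it inherits the distance-two condition.
  g-ok a = distance-two-coloring k 3≤k (g a) λ u x w ux xw eq →
    coloring-distance-two k 3≤k c c-ok (toℕ u + (k ∸ toℕ a)) (trans eq (cong c (begin
      (toℕ w + (k ∸ toℕ a)) mod k            ≡⟨ suc-target xw (k ∸ toℕ a) ⟩
      (suc (toℕ x) + (k ∸ toℕ a)) mod k      ≡⟨ cong (_mod k) (+-suc (toℕ x) (k ∸ toℕ a)) ⟨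
      (toℕ x + suc (k ∸ toℕ a)) mod k        ≡⟨ suc-target ux (suc (k ∸ toℕ a)) ⟩
      (suc (toℕ u) + suc (k ∸ toℕ a)) mod k  ≡⟨ cong (_mod k) (+-suc (suc (toℕ u)) (k ∸ toℕ a)) ⟩
      (2 + (toℕ u + (k ∸ toℕ a))) mod k      ∎)))

  separate : ∀ {x y i j : Fin 3} → x ≡ i → y ≡ j → i ≢ j → x ≢ y
  separate refl refl i≢j = i≢j

  -- Seen from `b`, the vertex `a` lies on the side opposite to `b` seen from `a`. So one colour
  -- belongs to offset -1 or 1, and the other to offset 0 or to offset ±2 of the opposite sign.
  across : ∀ a b u → Adj (C k 3≤k) a b → Adj (C k 3≤k) b u → g b a ≢ g a u
  across a b u (inj₁ ab) (inj₁ bu) = separate (at-−1 ab) (at-2 ab bu) λ ()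
  across a b u (inj₁ ab) (inj₂ ub) with CyclicPred-unique ab ub
  ... | refl = separate (at-−1 ab) (at-0 a) λ ()
  across a b u (inj₂ ba) (inj₁ bu) with CyclicSuc-unique ba bu
  ... | refl = separate (at-1 ba) (at-0 a) λ ()
  across a b u (inj₂ ba) (inj₂ ub) = separate (at-1 ba) (at-−2 ub ba) λ ()

  extreme : ∀ i j u → Adj (C k 3≤k) j u → g i i ≢ g j u
  extreme i j u (inj₁ ju) = separate (at-0 i) (at-1 ju) λ ()
  extreme i j u (inj₂ uj) = separate (at-0 i) (at-−1 uj) λ ()

C-3-colorable : ∀ k 3≤k → k % 4 ≢ 0 → ∀ n →
                InjectivelyColorable (Sierpiński (C k 3≤k) (suc n)) 3
C-3-colorable 0 () _ _
C-3-colorable 1 (s≤s ()) _ _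
C-3-colorable 2 (s≤s (s≤s ())) _ _
C-3-colorable 3 3≤k _ n = order-colorable-Sierpiński (C 3 3≤k) n
C-3-colorable 4 _ 4%4≢0 _ = contradiction refl 4%4≢0
C-3-colorable (suc (suc (suc (suc (suc m))))) 3≤k _ n = long-cycle-colorable m 3≤k n

-- The word `v0 v1` has two cycle neighbours in its own copy and a third neighbour `v1 v0` across a
-- crossing edge.
C²-colors-≥3 : ∀ k 3≤k {j} → InjectivelyColorable (Sierpiński (C k 3≤k) 2) j → 3 ≤ j
C²-colors-≥3 k 3≤k@(s≤s (s≤s (s≤s _))) c =
  degree≤colors (Sierpiński (C k 3≤k) 2) c z x adj distinct
  where
  v0 v1 v2 : Fin k
  v0 = zero
  v1 = suc zero
  v2 = suc (suc zero)

  z : Vec (Fin k) 2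
  z = v0 ∷ v1 ∷ []

  x : Fin 3 → Vec (Fin k) 2
  x zero             = v0 ∷ v0 ∷ []
  x (suc zero)       = v0 ∷ v2 ∷ []
  x (suc (suc zero)) = v1 ∷ v0 ∷ []

  adj : ∀ i → SierpińskiAdj (C k 3≤k) 2 (x i) z
  adj zero             = fromEdge (C k 3≤k) (within (cross (inj₁ (inj₁ refl)) refl refl))
  adj (suc zero)       = fromEdge (C k 3≤k) (within (cross (inj₂ (inj₁ refl)) refl refl))
  adj (suc (suc zero)) = fromEdge (C k 3≤k) (cross (inj₂ (inj₁ refl)) refl refl)

  distinct : ∀ i j → i ≢ j → x i ≢ x j
  distinct zero             zero             i≢j _ = i≢j refl
  distinct (suc zero)       (suc zero)       i≢j _ = i≢j refl
  distinct (suc (suc zero)) (suc (suc zero)) i≢j _ = i≢j refl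
  distinct zero             (suc zero)       _ ()
  distinct zero             (suc (suc zero)) _ ()
  distinct (suc zero)       zero             _ ()
  distinct (suc zero)       (suc (suc zero)) _ ()
  distinct (suc (suc zero)) zero             _ ()
  distinct (suc (suc zero)) (suc zero)       _ ()

-- Complete graphs

K-colors-≥ : ∀ p → 3 ≤ p → ∀ {k} → InjectivelyColorable (K p) k → p ≤ k
K-colors-≥ p 3≤p (f , ok) = Finₚ.injective⇒≤ {f = f} inj
  where
  third : ∀ {p} → 3 ≤ p → (u w : Fin p) → ∃[ x ] u ≢ x × w ≢ x
  third (s≤s (s≤s (s≤s _))) zero          zero          = suc zero , (λ ()) , λ ()
  third (s≤s (s≤s (s≤s _))) zero          (suc zero)    = suc (suc zero) , (λ ()) , λ ()
  third (s≤s (s≤s (s≤s _))) zero          (suc (suc _)) = suc zero , (λ ()) , λ ()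
  third (s≤s (s≤s (s≤s _))) (suc zero)    zero          = suc (suc zero) , (λ ()) , λ ()
  third (s≤s (s≤s (s≤s _))) (suc (suc _)) zero          = suc zero , (λ ()) , λ ()
  third (s≤s (s≤s (s≤s _))) (suc _)       (suc _)       = zero , (λ ()) , λ ()

  inj : ∀ {u w} → f u ≡ f w → u ≡ w
  inj {u} {w} eq with u Finₚ.≟ w
  ... | yes u≡w = u≡w
  -- Since `3 ≤ p`, any two vertices have a common neighbour, so no colour can be repeated.
  ... | no  u≢w = contradiction (third 3≤p u w) (ok u w u≢w eq)

-- Sharpness of both bounds

χᵢ-attains-lower : ∀ G n k → InjectivelyColorable (Sierpiński G (suc n)) k →
  (∀ {j} → InjectivelyColorable G j → k ≤ j) → χᵢ (Sierpiński G (suc n)) ≡ χᵢ G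
χᵢ-attains-lower G n k col bound = ≤-antisym
  (≤-trans (χᵢ-≤ (Sierpiński G (suc n)) col) (bound (χᵢ-colorable G)))
  (χᵢ-lower G (suc n) (s≤s z≤n))

χᵢ-K : ∀ p → 3 ≤ p → ∀ n → 1 ≤ n → χᵢ (Sierpiński (K p) n) ≡ χᵢ (K p)
χᵢ-K p@(suc _) 3≤p (suc n) _ = χᵢ-attains-lower (K p) n p
  (order-colorable-Sierpiński (K p) n) (K-colors-≥ p 3≤p)

χᵢ-C-≢0 : ∀ k 3≤k → k % 4 ≢ 0 → ∀ n → 1 ≤ n → χᵢ (Sierpiński (C k 3≤k) n) ≡ χᵢ (C k 3≤k)
χᵢ-C-≢0 k 3≤k k%4≢0 (suc n) _ = χᵢ-attains-lower (C k 3≤k) n 3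
  (C-3-colorable k 3≤k k%4≢0 n) (C-colors-≥3 k 3≤k k%4≢0)

χᵢ-C-≡0 : ∀ k 3≤k → k % 4 ≡ 0 → ∀ n → 2 ≤ n → χᵢ (Sierpiński (C k 3≤k) n) ≡ χᵢ (C k 3≤k) + 1
χᵢ-C-≡0 _ _ _ (suc zero) (s≤s ())
χᵢ-C-≡0 k@(suc _) 3≤k k%4≡0 (suc (suc n)) _ = ≤-antisym
  (χᵢ-upper (C k 3≤k) (suc (suc n)) (s≤s z≤n))
  (≤-trans (+-monoˡ-≤ 1 (χᵢ-≤ (C k 3≤k) (C-2-colorable k 3≤k k%4≡0)))
    (≥3 (χᵢ-colorable (Sierpiński (C k 3≤k) (suc (suc n))))))
  where
  ≥3 : ∀ {j} → InjectivelyColorable (Sierpiński (C k 3≤k) (2 + n)) j → 3 ≤ j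
  -- Fixing the first `n` letters restricts the colouring to a copy of the graph on two-letter
  -- words, which contains the vertex of degree 3.
  ≥3 {j} c = C²-colors-≥3 k 3≤k (colorable-drop (C k 3≤k) n 2 zero
    (subst (λ m → InjectivelyColorable (Sierpiński (C k 3≤k) m) j) (+-comm 2 n) c))

mainTheorem4 : (∀ (G : Graph) (n : ℕ) → 1 ≤ n →
    χᵢ G ≤ χᵢ (Sierpiński G n) × χᵢ (Sierpiński G n) ≤ χᵢ G + 1)
    × (∃[ G ] (∀ (n : ℕ) → 1 ≤ n → χᵢ (Sierpiński G n) ≡ χᵢ G))
    × (∀ (p : ℕ) → 3 ≤ p → ∀ (n : ℕ) → 1 ≤ n →
    χᵢ (Sierpiński (K p) n) ≡ χᵢ (K p))
    × (∀ (k : ℕ) (3≤k : 3 ≤ k) → k % 4 ≢ 0 → ∀ (n : ℕ) → 1 ≤ n →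
    χᵢ (Sierpiński (C k 3≤k) n) ≡ χᵢ (C k 3≤k))
    × (∃[ G ] (∀ (n : ℕ) → 2 ≤ n → χᵢ (Sierpiński G n) ≡ χᵢ G + 1))
    × (∀ (k : ℕ) (3≤k : 3 ≤ k) → k % 4 ≡ 0 → ∀ (n : ℕ) → 2 ≤ n →
    χᵢ (Sierpiński (C k 3≤k) n) ≡ χᵢ (C k 3≤k) + 1)
mainTheorem4 =
    (λ G n 1≤n → χᵢ-lower G n 1≤n , χᵢ-upper G n 1≤n)
  , (K 3 , χᵢ-K 3 ≤-refl)
  , χᵢ-K
  , χᵢ-C-≢0
  , (C 4 (n≤1+n 3) , χᵢ-C-≡0 4 (n≤1+n 3) refl)
  , χᵢ-C-≡0
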